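{- Every graph $G$ of treewidth $k$ has a subdivision $H$ whose radius-$1$ blind cop-width is at most $k+3$.
   Context: All graphs are finite, simple and undirected. A subdivision of $G$ is obtained by replacing each edge by a path of nonzero length, with these paths internally disjoint. For a graph $G$, a blind strategy of radius $1$ is a sequence $C_1,\dots,C_m\subseteq V(G)$ using $\max_i|C_i|$ cops, with $A_1=V(G)\setminus C_1$ and $A_{i+1}$ the set of $u\in V(G)\setminus C_{i+1}$ reachable from some vertex of $A_i$ by a path of length at most $1$ (length $0$ allowed) in $G\setminus(C_i\cap C_{i+1})$; it is winning if $A_m=\emptyset$. The radius-$1$ blind cop-width $\mathrm{bcw}_1(G)$ is the minimum number of cops of a winning strategy. -}

module Defs where

open import Data.Nat using (ℕ; zero; suc; _+_; _≤_; _<_)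
open import Data.Bool using (Bool; true; false; T)
open import Data.Fin using (Fin; zero; suc; inject₁; fromℕ) renaming (_<_ to _<ᶠ_)
open import Data.Fin.Subset using (Subset; _∈_; _∉_; _∩_; ∣_∣)
open import Data.List using (List; []; _∷_; _++_; [_])
open import Data.List.Relation.Unary.Linked using (Linked)
open import Data.List.Relation.Unary.Unique.Propositional using (Unique)
import Data.List.Membership.Propositional as LM
open import Data.List.Relation.Unary.All using (All)
open import Data.Product using (Σ; ∃; ∃-syntax; _×_; _,_)
open import Data.Sum using (_⊎_)
open import Data.Unit using (⊤)
open import Relation.Nullary using (¬_)
open import Relation.Binary.PropositionalEquality using (_≡_)
open import Function.Definitions using (Injective)

record Graph : Set where
  field
    n     : ℕ
    adj   : Fin n → Fin n → Bool
    sym   : ∀ u v → adj u v ≡ adj v u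
    irrefl : ∀ u → adj u u ≡ false

open Graph public

V : Graph → Set
V G = Fin (n G)

Edge : (G : Graph) → V G → V G → Set
Edge G u v = T (adj G u v)

data WalkIn (G : Graph) (P : V G → Set) : V G → V G → Set where
  here : ∀ {u} → P u → WalkIn G P u u
  step : ∀ {u w v} → P u → Edge G u w → WalkIn G P w v → WalkIn G P u v

Connected : Graph → Set
Connected G = ∀ u v → WalkIn G (λ _ → ⊤) u v

record Cycle (G : Graph) : Set where
  field
    m     : ℕ
    c     : Fin (suc (suc (suc m))) → V G
    inj   : Injective _≡_ _≡_ c
    cons  : ∀ (i : Fin (suc (suc m))) → Edge G (c (inject₁ i)) (c (suc i))
    close : Edge G (c (fromℕ (suc (suc m)))) (c zero)

Acyclic : Graph → Set
Acyclic G = ¬ Cycle G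

IsTree : Graph → Set
IsTree T = V T × Connected T × Acyclic T

record TreeDecomp (G : Graph) (k : ℕ) : Set where
  field
    tree      : Graph
    isTree    : IsTree tree
    bag       : V tree → Subset (n G)
    vertexCov : ∀ v → ∃[ t ] (v ∈ bag t)
    edgeCov   : ∀ u v → Edge G u v → ∃[ t ] (u ∈ bag t × v ∈ bag t)
    coherent  : ∀ v t t′ → v ∈ bag t → v ∈ bag t′ → WalkIn tree (λ s → v ∈ bag s) t t′
    width     : ∀ t → ∣ bag t ∣ ≤ suc k

Treewidth : Graph → ℕ → Set
Treewidth G k = TreeDecomp G k × (∀ j → j < k → ¬ TreeDecomp G j)

Consecutive : {A : Set} → A → A → List A → Set
Consecutive {A} x y xs = ∃[ ys ] ∃[ zs ] (xs ≡ ys ++ (x ∷ y ∷ zs))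

-- H is a subdivision of G: each edge uv (u < v) of G is replaced by the
-- path  branch u , inner u v , branch v  in H; these paths are internally
-- disjoint, and H is exactly their union.
record Subdivision (G H : Graph) : Set where
  field
    branch    : V G → V H
    branchInj : Injective _≡_ _≡_ branch
    inner     : V G → V G → List (V H)
  path : V G → V G → List (V H)
  path u v = branch u ∷ (inner u v ++ [ branch v ])
  field
    pathWalk  : ∀ u v → u <ᶠ v → Edge G u v → Linked (Edge H) (path u v)
    innerUniq : ∀ u v → u <ᶠ v → Edge G u v → Unique (inner u v)
    innerNotBranch : ∀ u v → u <ᶠ v → Edge G u v → ∀ x → x LM.∈ inner u v → ∀ w → ¬ (branch w ≡ x)
    disjoint  : ∀ u v u′ v′ → u <ᶠ v → Edge G u v → u′ <ᶠ v′ → Edge G u′ v′ →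
                ∀ x → x LM.∈ inner u v → x LM.∈ inner u′ v′ → (u ≡ u′ × v ≡ v′)
    vertexCov : ∀ x → (∃[ w ] (branch w ≡ x)) ⊎
                      (∃[ u ] ∃[ v ] (u <ᶠ v × Edge G u v × x LM.∈ inner u v))
    edgeCov   : ∀ x y → Edge H x y →
                ∃[ u ] ∃[ v ] (u <ᶠ v × Edge G u v × (Consecutive x y (path u v) ⊎ Consecutive y x (path u v)))

-- Given C_i, A_i and the remaining cop sets C_{i+1}, …, C_m, compute A_m.
-- A_{i+1} = { u ∉ C_{i+1} | ∃ a ∈ A_i, a path of length ≤ 1 from a to u
--             in G ∖ (C_i ∩ C_{i+1}) }.
evolve : (G : Graph) → Subset (n G) → (V G → Set) → List (Subset (n G)) → (V G → Set)
evolve G C A [] = A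
evolve G C A (C′ ∷ Cs) =
  evolve G C′
    (λ u → u ∉ C′ × ∃[ a ] (A a × (a ≡ u ⊎ (Edge G a u × a ∉ (C ∩ C′) × u ∉ (C ∩ C′)))))
    Cs

Winning : (G : Graph) → Subset (n G) → List (Subset (n G)) → Set
Winning G C₁ Cs = ∀ u → ¬ evolve G C₁ (λ v → v ∉ C₁) Cs u

BCW₁≤ : Graph → ℕ → Set
BCW₁≤ G c = ∃[ C₁ ] ∃[ Cs ] (Winning G C₁ Cs × All (λ C → ∣ C ∣ ≤ c) (C₁ ∷ Cs))

{-# OPTIONS --safe #-}

-- Subdivide the edges to very different lengths, and let the cops traverse a rooted tree
-- decomposition depth first, always guarding a bag, with two further cops to sweep an edge.
-- Of two branches at a bag X, the one visited first gets edges far longer than the time spent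
-- in the second. During the excursion X is left unguarded, but contamination spreads by one
-- vertex per step, so in the first branch it only reaches the initial segments of the edges
-- leaving X; back at X, these are swept one by one.
module Submission where

open import Defs
open import Data.Bool using (T; _∨_; false)
open import Data.Bool.Properties using (T?; T-∨; ∨-comm)
open import Data.Empty using (⊥; ⊥-elim)
open import Data.Fin using (Fin; zero; suc; inject₁; fromℕ) renaming (_<_ to _<ᶠ_)
import Data.Fin.Properties as Fin
open import Data.Fin.Subset using (Subset; ∣_∣; inside; outside)
import Data.Fin.Subset as Subset
import Data.Fin.Subset.Properties as Subset
open import Data.List using (List; []; _∷_; _++_; [_]; map; length; lookup; filter; allFin;
  cartesianProduct; deduplicate; concatMap; applyUpTo; applyDownFrom; last)
open import Data.List.Properties using (length-map; length-++; map-++; ++-assoc; filter-notAll;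
  applyUpTo-∷ʳ; applyDownFrom-∷ʳ; ∷-injective)
import Data.List.Membership.DecPropositional as DecMembership
open import Data.List.Membership.Propositional using (_∈_; _∉_; find; lose)
open import Data.List.Membership.Propositional.Properties
open import Data.List.Relation.Unary.All using (All; []; _∷_)
import Data.List.Relation.Unary.All as All
import Data.List.Relation.Unary.All.Properties as All
open import Data.List.Relation.Unary.AllPairs using ([]; _∷_)
open import Data.List.Relation.Unary.Any using (here; there; any?)
import Data.List.Relation.Unary.Any as Any
import Data.List.Relation.Unary.Any.Properties as Any
open import Data.List.Relation.Unary.Linked using (Linked; [-]; _∷_)
import Data.List.Relation.Unary.Linked as Linked
import Data.List.Relation.Unary.Linked.Properties as LinkedP
import Data.List.Relation.Unary.Unique.DecPropositional.Properties as DecUnique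
open import Data.List.Relation.Unary.Unique.Propositional using (Unique)
import Data.List.Relation.Unary.Unique.Propositional.Properties as Unique
open import Data.Maybe using (just)
open import Data.Maybe.Relation.Binary.Connected using (just) renaming (Connected to MaybeRelated)
open import Data.Nat using (ℕ; _+_)
open import Data.Nat using (zero; suc; pred; _≤_; _<_; _≤?_; _⊔_; z≤n; s≤s; s≤s⁻¹)
import Data.Nat as ℕ
open import Data.Nat.Properties
open import Data.Product using (∃-syntax; _×_)
open import Data.Product using (Σ-syntax; _,_; proj₁; proj₂)
open import Data.Sum using (_⊎_; inj₁; inj₂)
import Data.Sum as Sum
open import Data.Unit using (⊤; tt)
open import Data.Vec using ([]; _∷_; _[_]≔_)
import Data.Vec as Vec
import Data.Vec.Properties as Vec
open import Function using (_∘_; id; Equivalence)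
open import Relation.Binary using (tri<; tri≈; tri>; DecidableEquality)
open import Relation.Binary.PropositionalEquality using (_≡_; _≢_; refl; cong; subst)
import Relation.Binary.PropositionalEquality as ≡
open import Relation.Nullary using (¬_; Dec; yes; no; ¬?)
open import Relation.Nullary.Decidable using (decidable-stable; map′; _×-dec_; _⊎-dec_; ⌊_⌋;
  toWitness; fromWitness)
open import Relation.Unary using (Decidable)

-- While a second branch is searched, no cop can be spared for `X`: a bag of up to `k + 1` vertices
-- and the two sweepers already use `k + 3`. Time is then the only protection of a cleared branch,
-- so lengths must be chosen in the reverse order of play: the strategy for the later branch
-- determines a number of rounds, and the lengths in the earlier branch are chosen to exceed it. For
-- the recursion to permit this, a strategy must work from any contamination, for any lengths of the
-- edges elsewhere, and with its own lengths above any prescribed bound. A sweep takes two cops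
-- because a robber may leave a vertex in the very round in which a cop lands on it; the second cop
-- occupies the vertex to which it would slip past the first.

module Pursuit (G : Graph) where

  -- The edge u v becomes br u, hf u v 0, …, hf u v (L u v), hf v u (L v u), …, hf v u 0, br v:
  -- two halves, so that both ends of an edge are treated alike.
  data Position : Set where
    br : V G → Position
    hf : (u v : V G) (i : ℕ) → Position

  Lengths : Set
  Lengths = V G → V G → ℕ

  Cops : Set
  Cops = List Position

  edge-sym : ∀ {u v} → Edge G u v → Edge G v u
  edge-sym {u} {v} = subst T (Graph.sym G u v)

  -- The pursuit of a single robber.

  module Chase (L : Lengths) where

    -- Positions do not depend on `L`, only moves do, so one list of cop sets can be played on
    -- subdivisions with different lengths. `along` with `i = j` is waiting inside an edge. Every
    -- move from a half carries its edge, since positions are also formed for non-adjacent pairs.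
    data Move : Position → Position → Set where
      rest  : ∀ {u} → Move (br u) (br u)
      leave : ∀ {u v} → Edge G u v → Move (br u) (hf u v 0)
      enter : ∀ {u v} → Edge G u v → Move (hf u v 0) (br u)
      along : ∀ {u v i j} → Edge G u v → j ≤ suc i → i ≤ suc j → i ≤ L u v → j ≤ L u v →
              Move (hf u v i) (hf u v j)
      cross : ∀ {u v} → Edge G u v → Move (hf u v (L u v)) (hf v u (L v u))

    -- A_{i+1} is contained in N[A_i] ∖ C_{i+1}, so it is enough to follow a single robber.
    data Evade : List Cops → Position → Position → Set where
      done : ∀ {a} → Evade [] a a
      move : ∀ {C Cs a q p} → Move a q → q ∉ C → Evade Cs q p → Evade (C ∷ Cs) a p

    Forces₁ : (Position → Set) → Cops → (Position → Set) → Set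
    Forces₁ P C Q = ∀ {a p} → P a → Move a p → p ∉ C → Q p

    Forces : (Position → Set) → List Cops → (Position → Set) → Set
    Forces P Cs Q = ∀ {a p} → P a → Evade Cs a p → Q p

    forces-∷ : ∀ {P Q R C Cs} → Forces₁ P C Q → Forces Q Cs R → Forces P (C ∷ Cs) R
    forces-∷ f g Pa (move a~q q∉C e) = g (f Pa a~q q∉C) e

    evade-++⁻ : ∀ Cs {Ds a p} → Evade (Cs ++ Ds) a p → ∃[ q ] (Evade Cs a q × Evade Ds q p)
    evade-++⁻ []       e              = _ , done , e
    evade-++⁻ (C ∷ Cs) (move m q∉C e) =
      let q , e₁ , e₂ = evade-++⁻ Cs e in q , move m q∉C e₁ , e₂

    forces-++ : ∀ {P Q R} Cs {Ds} → Forces P Cs Q → Forces Q Ds R → Forces P (Cs ++ Ds) R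
    forces-++ Cs f g Pa e = let _ , e₁ , e₂ = evade-++⁻ Cs e in g (f Pa e₁) e₂

    source-edge : ∀ {u v i p} → Move (hf u v i) p → Edge G u v
    source-edge (enter e)         = e
    source-edge (along e _ _ _ _) = e
    source-edge (cross e)         = e

  -- Guarded bags, and stubs of edges that lead into a cleared set.

  guard : List (V G) → Cops → Cops
  guard X ps = map br X ++ ps

  guard-br : ∀ {X ps v} → v ∈ X → br v ∈ guard X ps
  guard-br v∈X = ∈-++⁺ˡ (∈-map⁺ br v∈X)

  guard-extra : ∀ X {ps p} → p ∈ ps → p ∈ guard X ps
  guard-extra X = ∈-++⁺ʳ (map br X)

  Guarding : List (V G) → Cops → Set
  Guarding X C = ∃[ ps ] (C ≡ guard X ps × length ps ≤ 2)

  Off : List (V G) → Position → Set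
  Off X p = ∀ v → v ∈ X → p ≢ br v

  off-guarding : ∀ {X C p} → Guarding X C → p ∉ C → Off X p
  off-guarding (_ , refl , _) p∉C v v∈X refl = p∉C (guard-br v∈X)

  length-guarding : ∀ {X C} → Guarding X C → length C ≤ length X + 2
  length-guarding {X} (ps , refl , ps≤2) = begin
    length (map br X ++ ps)     ≡⟨ length-++ (map br X) ⟩
    length (map br X) + length ps ≡⟨ cong (_+ length ps) (length-map br X) ⟩
    length X + length ps        ≤⟨ +-monoʳ-≤ (length X) ps≤2 ⟩
    length X + 2                ∎
    where open ≤-Reasoning

  -- From indices below `suc j` a robber gets at most to `suc j`. The cops on `j` and `suc j`
  -- therefore leave only indices below `j`.
  retreat : List (V G) → V G → V G → ℕ → List Cops
  retreat X u v zero    = []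
  retreat X u v (suc j) = guard X (hf u v j ∷ hf u v (suc j) ∷ []) ∷ retreat X u v j

  retreat-guarding : ∀ X u v j → All (Guarding X) (retreat X u v j)
  retreat-guarding X u v zero    = []
  retreat-guarding X u v (suc j) = (_ , refl , ≤-refl) ∷ retreat-guarding X u v j

  -- U is cleared, except for the stubs (u , v , i) in F, whose edges lead into U from outside.
  Outside : (V G → Set) → (V G → V G → ℕ → Set) → Position → Set
  Outside U F (br u)     = ¬ U u
  Outside U F (hf u v i) = ¬ U u × (U v → F u v i)

  Nowhere : V G → V G → ℕ → Set
  Nowhere _ _ _ = ⊥

  Shallow : ℕ → V G → V G → ℕ → Set
  Shallow d _ _ i = i < d

  outside-mono : ∀ {U F F′} → (∀ {u v i} → F u v i → F′ u v i) →
                 ∀ p → Outside U F p → Outside U F′ p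
  outside-mono F⊆F′ (br u)     ¬Uu       = ¬Uu
  outside-mono F⊆F′ (hf u v i) (¬Uu , f) = ¬Uu , F⊆F′ ∘ f

  Neighbours⊆ : (V G → Set) → List (V G) → Set
  Neighbours⊆ U X = ∀ {u v} → U u → Edge G u v → U v ⊎ v ∈ X

  -- The stub `(x , y)` is being swept and is contaminated below `j`; those in `es` still wait,
  -- contaminated below `d`; all others are empty.
  Sweeping : V G → V G → ℕ → List (V G × V G) → ℕ → V G → V G → ℕ → Set
  Sweeping x y j es d u v i = (u ≡ x × v ≡ y × i < j) ⊎ ((u , v) ∈ es × i < d)

  module _ {L : Lengths} where
    open Chase L

    -- A robber outside `U` threatens it in three ways, with one hypothesis for each: crossing the
    -- middle at the end of a stub, moving within a stub, and starting a stub from its outer end.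
    outside-step : ∀ {U F F′ C} {a p} → (∀ {u v} → Edge G u v → U v → ¬ F u v (L u v)) →
      (∀ {u v i j} → F u v i → j ≤ suc i → i ≤ suc j → hf u v j ∉ C → F′ u v j) →
      (∀ {u v} → a ≡ br u → Edge G u v → ¬ U u → U v → F′ u v 0) →
      Outside U F a → Move a p → p ∉ C → Outside U F′ p
    outside-step mid drift new ¬Ua         rest              p∉C = ¬Ua
    outside-step mid drift new ¬Uu         (leave e)         p∉C = ¬Uu , new refl e ¬Uu
    outside-step mid drift new (¬Uu , f)   (enter e)         p∉C = ¬Uu
    outside-step mid drift new (¬Uu , f)   (along e l l′ _ _) p∉C =
      ¬Uu , λ Uv → drift (f Uv) l l′ p∉C
    outside-step mid drift new (¬Uu , f)   (cross e)         p∉C =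
      (λ Uv → mid e Uv (f Uv)) , ⊥-elim ∘ ¬Uu

    off-not-entering : ∀ {U X a} → Neighbours⊆ U X → Off X a →
      ∀ {u v} → a ≡ br u → Edge G u v → ¬ U u → U v → ⊥
    off-not-entering N⊆ off a≡ e ¬Uu Uv with N⊆ Uv (edge-sym e)
    ... | inj₁ Uu  = ¬Uu Uu
    ... | inj₂ u∈X = off _ u∈X a≡

    -- Contamination of the edges leading into U advances by at most one vertex per step.
    drift : ∀ {U} Cs d → (∀ {u v} → Edge G u v → U v → length Cs + d ≤ L u v) →
            Forces (Outside U (Shallow d)) Cs (Outside U (Shallow (length Cs + d)))
    drift []       d dL out done = out
    drift {U} (C ∷ Cs) d dL {p = p} out (move m p∉C e) =
      subst (λ k → Outside U (Shallow k) p) (+-suc (length Cs) d)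
        (drift Cs (suc d) (λ {u} {v} e Uv →
            subst (_≤ L u v) (≡.sym (+-suc (length Cs) d)) (dL e Uv))
          (outside-step (λ e Uv L<d → <⇒≱ L<d (≤-trans (m≤n+m d _) (dL e Uv)))
             (λ i<d j≤ _ _ → s≤s (≤-trans j≤ i<d)) (λ _ _ _ _ → s≤s z≤n) out m p∉C) e)

    -- Without stubs, the only way in starts at a vertex of `X`. So only the point of departure
    -- counts and `C` is arbitrary, which later allows one guarded bag to be exchanged for another
    -- in a single round.
    outside-held : ∀ {U X C} → Neighbours⊆ U X →
      Forces₁ (λ a → Off X a × Outside U Nowhere a) C (Outside U Nowhere)
    outside-held {U} N⊆ (off , out) =
      outside-step {F = Nowhere} (λ _ _ ()) (λ ()) (off-not-entering {U} N⊆ off) out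

    -- `P` has to survive only moves that depart off `X`; the guards of each round renew this
    -- condition for the next.
    off-kept : ∀ {X P Cs} → All (Guarding X) Cs →
      (∀ {C} → Forces₁ (λ a → Off X a × P a) C P) →
      Forces (λ a → Off X a × P a) Cs (λ a → Off X a × P a)
    off-kept []       keep P              done            = P
    off-kept (g ∷ gs) keep P (move m p∉C e) =
      off-kept gs keep (off-guarding g p∉C , keep P m p∉C) e

    -- Two cops walk towards the guarded vertex x; the other stubs deepen meanwhile.
    retreat-stub : ∀ {U X} → Neighbours⊆ U X → ∀ x y es j d →
      (∀ {u v} → Edge G u v → U v → j + d ≤ L u v) →
      Forces (λ a → Off X a × Outside U (Sweeping x y j es d) a) (retreat X x y j)
             (λ a → Off X a × Outside U (Sweeping x y 0 es (j + d)) a)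
    retreat-stub N⊆ x y es zero    d jdL = λ { P done → P }
    retreat-stub {U} {X} N⊆ x y es (suc j) d jdL = forces-∷ one
      (subst (λ k → Forces (λ a → Off X a × Outside U (Sweeping x y j es (suc d)) a)
                              (retreat X x y j)
                              (λ a → Off X a × Outside U (Sweeping x y 0 es k) a))
        (+-suc j d)
        (retreat-stub N⊆ x y es j (suc d)
          (λ {u} {v} e Uv → subst (_≤ L u v) (≡.sym (+-suc j d)) (jdL e Uv))))
      where
      C : Cops
      C = guard X (hf x y j ∷ hf x y (suc j) ∷ [])
      mid : ∀ {u v} → Edge G u v → U v → ¬ Sweeping x y (suc j) es d u v (L u v)
      mid e Uv (inj₁ (_ , _ , L<)) = <⇒≱ L< (≤-trans (m≤m+n (suc j) d) (jdL e Uv))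
      mid e Uv (inj₂ (_ , L<))     = <⇒≱ L< (≤-trans (m≤n+m d (suc j)) (jdL e Uv))
      pushed : ∀ {u v i i′} → Sweeping x y (suc j) es d u v i → i′ ≤ suc i → i ≤ suc i′ →
               hf u v i′ ∉ C → Sweeping x y j es (suc d) u v i′
      pushed (inj₂ (e∈ , i<d)) i′≤ _ _ = inj₂ (e∈ , s≤s (≤-trans i′≤ i<d))
      pushed {i′ = i′} (inj₁ (refl , refl , i<)) i′≤ _ p∉C = inj₁ (refl , refl , ≤∧≢⇒<
        (s≤s⁻¹ (≤∧≢⇒< (≤-trans i′≤ i<) λ { refl → p∉C (guard-extra X (there (here refl))) }))
        λ { refl → p∉C (guard-extra X (here refl)) })
      one : Forces₁ (λ a → Off X a × Outside U (Sweeping x y (suc j) es d) a) C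
                    (λ a → Off X a × Outside U (Sweeping x y j es (suc d)) a)
      one (off , out) m p∉C = off-guarding {X} (_ , refl , ≤-refl) p∉C ,
        outside-step mid pushed
          (λ a≡ e ¬Uu Uv → ⊥-elim (off-not-entering {U} {X} N⊆ off a≡ e ¬Uu Uv)) out m p∉C

  sweepStubs : List (V G) → List (V G × V G) → ℕ → List Cops
  sweepStubs X []             d = []
  sweepStubs X ((u , v) ∷ es) d = retreat X u v d ++ sweepStubs X es (d + d)

  -- Sweeping a stub of depth `d` takes `d` rounds, in which the waiting stubs grow to `d + d`: the
  -- depth doubles with each entry.
  finalDepth : List (V G × V G) → ℕ → ℕ
  finalDepth []       d = d
  finalDepth (_ ∷ es) d = finalDepth es (d + d)

  d≤finalDepth : ∀ es d → d ≤ finalDepth es d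
  d≤finalDepth []       d = ≤-refl
  d≤finalDepth (_ ∷ es) d = ≤-trans (m≤m+n d d) (d≤finalDepth es (d + d))

  sweepStubs-guarding : ∀ X es d → All (Guarding X) (sweepStubs X es d)
  sweepStubs-guarding X []             d = []
  sweepStubs-guarding X ((u , v) ∷ es) d =
    All.++⁺ (retreat-guarding X u v d) (sweepStubs-guarding X es (d + d))

  -- A swept stub stays empty because its outer end lies in the guarded `X`. Entries of `es` that do
  -- not lead into `U` from outside merely cost time.
  stubs-swept : ∀ {L : Lengths} {U X} → Neighbours⊆ U X →
    ∀ es d → (∀ {u v} → Edge G u v → U v → finalDepth es d ≤ L u v) →
    Chase.Forces L (λ a → Off X a × Outside U (λ u v i → (u , v) ∈ es × i < d) a)
      (sweepStubs X es d) (λ a → Off X a × Outside U Nowhere a)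
  stubs-swept N⊆ [] d dL {a} (off , out) Chase.done = off , outside-mono (λ ()) a out
  stubs-swept {L} {U} {X} N⊆ ((x , y) ∷ es) d dL = forces-++ (retreat X x y d)
    (λ {a} P → retreat-stub N⊆ x y es d d (λ e Uv → ≤-trans (d≤finalDepth es (d + d)) (dL e Uv))
             (start a P))
    (λ {a} P → stubs-swept N⊆ es (d + d) dL (stop a P))
    where
    open Chase L
    start : ∀ a → Off X a × Outside U (λ u v i → (u , v) ∈ (x , y) ∷ es × i < d) a →
            Off X a × Outside U (Sweeping x y d es d) a
    start a (off , out) = off , outside-mono
      (λ { (here refl , i<) → inj₁ (refl , refl , i<) ; (there e∈ , i<) → inj₂ (e∈ , i<) }) a out
    stop : ∀ a → Off X a × Outside U (Sweeping x y 0 es (d + d)) a →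
           Off X a × Outside U (λ u v i → (u , v) ∈ es × i < d + d) a
    stop a (off , out) = off ,
      outside-mono {F = Sweeping x y 0 es (d + d)}
        (λ { (inj₂ z) → z ; (inj₁ (_ , _ , ())) }) a out

  -- Sweeping whole edges between two guarded vertices.

  -- The mirror image of `retreat`: contamination from `j` upwards can fall back to `pred j` at
  -- most. In the round `j = 0` both cops stand on index `0`, as the end of the edge is guarded
  -- anyway.
  advance : List (V G) → V G → V G → ℕ → ℕ → List Cops
  advance X u v j zero    = []
  advance X u v j (suc m) = guard X (hf u v (pred j) ∷ hf u v j ∷ []) ∷ advance X u v (suc j) m

  -- The indices `0` to `L u v` take `suc (L u v)` rounds; one more round occupies both middle
  -- vertices, and the far half is then swept towards `v`.
  sweepEdge : List (V G) → Lengths → V G → V G → List Cops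
  sweepEdge X L u v =
    advance X u v 0 (suc (L u v)) ++
    guard X (hf u v (L u v) ∷ hf v u (L v u) ∷ []) ∷ retreat X v u (L v u)

  sweepEdges : List (V G) → Lengths → List (V G × V G) → List Cops
  sweepEdges X L []             = []
  sweepEdges X L ((u , v) ∷ es) = sweepEdge X L u v ++ sweepEdges X L es

  advance-guarding : ∀ X u v j m → All (Guarding X) (advance X u v j m)
  advance-guarding X u v j zero    = []
  advance-guarding X u v j (suc m) = (_ , refl , ≤-refl) ∷ advance-guarding X u v (suc j) m

  sweepEdge-guarding : ∀ X L u v → All (Guarding X) (sweepEdge X L u v)
  sweepEdge-guarding X L u v = All.++⁺ (advance-guarding X u v 0 (suc (L u v)))
    ((hf u v (L u v) ∷ hf v u (L v u) ∷ [] , refl , ≤-refl) ∷ retreat-guarding X v u (L v u))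

  sweepEdges-guarding : ∀ X L es → All (Guarding X) (sweepEdges X L es)
  sweepEdges-guarding X L []             = []
  sweepEdges-guarding X L ((u , v) ∷ es) =
    All.++⁺ (sweepEdge-guarding X L u v) (sweepEdges-guarding X L es)

  -- A constraint on the index if the robber is in this half, and none otherwise; the constantly
  -- false `R` says that it is not there.
  On : V G → V G → (ℕ → Set) → Position → Set
  On u v R p = ∀ {i} → p ≡ hf u v i → R i

  OffEdge : V G → V G → Position → Set
  OffEdge u v p = On u v (λ _ → ⊥) p × On v u (λ _ → ⊥) p

  module _ {L : Lengths} where
    open Chase L

    advance-sweeps : ∀ {X u v} → u ∈ X → ∀ j m → j + m ≤ suc (L u v) →
      Forces (λ a → Off X a × On u v (j ≤_) a) (advance X u v j m)
             (λ a → Off X a × On u v (j + m ≤_) a)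
    advance-sweeps {X} {u} {v} u∈X j zero    j≤ {p = p} P done =
      subst (λ k → Off X p × On u v (k ≤_) p) (≡.sym (+-identityʳ j)) P
    advance-sweeps {X} {u} {v} u∈X j (suc m) j≤ = forces-∷
      {Q = λ a → Off X a × On u v (suc j ≤_) a} one
      (subst (λ k → Forces (λ a → Off X a × On u v (suc j ≤_) a) (advance X u v (suc j) m)
                           (λ a → Off X a × On u v (k ≤_) a))
        (≡.sym (+-suc j m))
        (advance-sweeps u∈X (suc j) m (subst (_≤ suc (L u v)) (+-suc j m) j≤)))
      where
      C : Cops
      C = guard X (hf u v (pred j) ∷ hf u v j ∷ [])
      beyond : ∀ j i → i ≢ pred j → i ≢ j → j ≤ suc i → suc j ≤ i
      beyond zero    i ≢p ≢j j≤ = ≤∧≢⇒< z≤n (≢j ∘ ≡.sym)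
      beyond (suc j) i ≢p ≢j j≤ = ≤∧≢⇒< (≤∧≢⇒< (s≤s⁻¹ j≤) (≢p ∘ ≡.sym)) (≢j ∘ ≡.sym)
      pushed : ∀ {i} → hf u v i ∉ C → j ≤ suc i → suc j ≤ i
      pushed {i} p∉C = beyond j i (λ { refl → p∉C (guard-extra X (here refl)) })
                                  (λ { refl → p∉C (guard-extra X (there (here refl))) })
      j≤L : j ≤ L u v
      j≤L = ≤-trans (m≤m+n j m) (s≤s⁻¹ (subst (_≤ suc (L u v)) (+-suc j m) j≤))
      new : ∀ {a i} → Off X a → On u v (j ≤_) a → Move a (hf u v i) → hf u v i ∉ C → suc j ≤ i
      new off on (leave _)            p∉C = ⊥-elim (off _ u∈X refl)
      new off on (along _ _ i≤ _ _)   p∉C = pushed p∉C (≤-trans (on refl) i≤)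
      new off on (cross _)            p∉C = pushed p∉C (m≤n⇒m≤1+n j≤L)
      one : Forces₁ (λ a → Off X a × On u v (j ≤_) a) C (λ a → Off X a × On u v (suc j ≤_) a)
      one (off , on) m p∉C = off-guarding {X} (_ , refl , ≤-refl) p∉C ,
        λ { refl → new off on m p∉C }

    -- The bound `suc (L u v) ≤_` amounts to an empty near half, since no move leaves an index
    -- beyond `L u v`. The cop on the near middle vertex blocks the return across the middle, and
    -- the other clears the last index of the far half.
    turn : ∀ {X u v} → u ∈ X → v ∈ X →
      Forces₁ (λ a → Off X a × On u v (suc (L u v) ≤_) a)
              (guard X (hf u v (L u v) ∷ hf v u (L v u) ∷ []))
              (λ a → Off X a × On u v (λ _ → ⊥) a × On v u (_< L v u) a)
    turn {X} {u} {v} u∈X v∈X (off , on) m p∉C = off-guarding {X} (_ , refl , ≤-refl) p∉C ,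
      (λ { refl → near off on m p∉C }) , (λ { refl → far off on m p∉C })
      where
      C : Cops
      C = guard X (hf u v (L u v) ∷ hf v u (L v u) ∷ [])
      near : ∀ {a i} → Off X a → On u v (suc (L u v) ≤_) a → Move a (hf u v i) → hf u v i ∉ C → ⊥
      near off on (leave _)           p∉C = off _ u∈X refl
      near off on (along _ _ _ i≤L _) p∉C = <⇒≱ (on refl) i≤L
      near off on (cross _)           p∉C = p∉C (guard-extra X (here refl))
      far : ∀ {a i} → Off X a → On u v (suc (L u v) ≤_) a → Move a (hf v u i) → hf v u i ∉ C →
            i < L v u
      far off on (leave _)           p∉C = ⊥-elim (off _ v∈X refl)
      far off on (along _ _ _ _ i≤L) p∉C =
        ≤∧≢⇒< i≤L λ { refl → p∉C (guard-extra X (there (here refl))) }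
      far off on (cross _)           p∉C = ⊥-elim (<-irrefl refl (on refl))

    retreat-edge : ∀ {X u v} → u ∈ X → v ∈ X → ∀ j → j ≤ L u v →
      Forces (λ a → Off X a × On v u (λ _ → ⊥) a × On u v (_< j) a) (retreat X u v j)
             (λ a → Off X a × OffEdge v u a)
    retreat-edge u∈X v∈X zero    j≤L (off , on , on′) done =
      off , on , λ p≡ → ⊥-elim (n≮0 (on′ p≡))
    retreat-edge {X} {u} {v} u∈X v∈X (suc j) j≤L = forces-∷ one
      (retreat-edge u∈X v∈X j (<⇒≤ j≤L))
      where
      C : Cops
      C = guard X (hf u v j ∷ hf u v (suc j) ∷ [])
      far : ∀ {a i} → Off X a → On v u (λ _ → ⊥) a → On u v (_< suc j) a → Move a (hf v u i) → ⊥
      far off on on′ (leave _)         = off _ v∈X refl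
      far off on on′ (along _ _ _ _ _) = on refl
      far off on on′ (cross _)         = <⇒≱ (on′ refl) j≤L
      near : ∀ {a i} → Off X a → On v u (λ _ → ⊥) a → On u v (_< suc j) a → Move a (hf u v i) →
             hf u v i ∉ C → i < j
      near off on on′ (leave _)          p∉C = ⊥-elim (off _ u∈X refl)
      near off on on′ (along _ i≤ _ _ _) p∉C = ≤∧≢⇒<
        (s≤s⁻¹ (≤∧≢⇒< (≤-trans i≤ (on′ refl))
          λ { refl → p∉C (guard-extra X (there (here refl))) }))
        λ { refl → p∉C (guard-extra X (here refl)) }
      near off on on′ (cross _)          p∉C = ⊥-elim (on refl)
      one : Forces₁ (λ a → Off X a × On v u (λ _ → ⊥) a × On u v (_< suc j) a) C
                    (λ a → Off X a × On v u (λ _ → ⊥) a × On u v (_< j) a)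
      one (off , on , on′) m p∉C = off-guarding {X} (_ , refl , ≤-refl) p∉C ,
        (λ { refl → far off on on′ m }) , (λ { refl → near off on on′ m p∉C })

    offEdge-held : ∀ {X u v C} → u ∈ X → v ∈ X →
      Forces₁ (λ a → Off X a × OffEdge u v a) C (OffEdge u v)
    offEdge-held {X} u∈X v∈X (off , on , on′) m _ =
      (λ { refl → kept u∈X off on on′ m }) , (λ { refl → kept v∈X off on′ on m })
      where
      kept : ∀ {u v a i} → u ∈ X → Off X a → On u v (λ _ → ⊥) a → On v u (λ _ → ⊥) a →
             Move a (hf u v i) → ⊥
      kept u∈X off on on′ (leave _)         = off _ u∈X refl
      kept u∈X off on on′ (along _ _ _ _ _) = on refl
      kept u∈X off on on′ (cross _)         = on′ refl

    edge-swept : ∀ {X u v L₀} → u ∈ X → v ∈ X → L u v ≡ L₀ u v → L v u ≡ L₀ v u →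
      Forces (Off X) (sweepEdge X L₀ u v) (λ a → Off X a × OffEdge u v a)
    edge-swept {X} {u} {v} u∈X v∈X eq eq′ rewrite ≡.sym eq | ≡.sym eq′ =
      forces-++ (advance X u v 0 (suc (L u v)))
        (λ off → advance-sweeps u∈X 0 (suc (L u v)) ≤-refl (off , λ _ → z≤n))
        (forces-∷ (turn u∈X v∈X) (retreat-edge v∈X u∈X (L v u) ≤-refl))

    off-held : ∀ {X Cs} → All (Guarding X) Cs → Forces (Off X) Cs (Off X)
    off-held gs off e = proj₁ (off-kept {P = λ _ → ⊤} gs (λ _ _ _ → tt) (off , tt) e)

    -- The sweeps are planned with `L₀` but played with `L`. Where the two differ a sweep may fail,
    -- but it still guards `X`, which keeps the edges already swept empty.
    edges-swept : ∀ {X L₀} es → Forces (Off X) (sweepEdges X L₀ es) (λ a → ∀ {u v} →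
      (u , v) ∈ es → u ∈ X → v ∈ X → L u v ≡ L₀ u v → L v u ≡ L₀ v u → OffEdge u v a)
    edges-swept {X} {L₀} ((u , v) ∷ es) off e (here refl) u∈X v∈X eq eq′ =
      let _ , e₁ , e₂ = evade-++⁻ (sweepEdge X L₀ u v) e in
      proj₂ (off-kept (sweepEdges-guarding X L₀ es) (offEdge-held u∈X v∈X)
        (edge-swept {L₀ = L₀} u∈X v∈X eq eq′ off e₁) e₂)
    edges-swept {X} {L₀} ((u , v) ∷ es) off e (there e∈) =
      let _ , e₁ , e₂ = evade-++⁻ (sweepEdge X L₀ u v) e in
      edges-swept es (off-held (sweepEdge-guarding X L₀ u v) off e₁) e₂ e∈

  -- Strategies that clear a set of vertices, and their combination.

  arcs : List (V G × V G)
  arcs = cartesianProduct (allFin (n G)) (allFin (n G))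

  ∈-arcs : ∀ {u v} → (u , v) ∈ arcs
  ∈-arcs = ∈-cartesianProduct⁺ (∈-allFin _) (∈-allFin _)

  -- Both halves of every edge touching `U`: exactly the lengths on which a strategy for `U` may
  -- rely.
  Agree : (V G → Set) → Lengths → Lengths → Set
  Agree U L L₀ = ∀ u v → U u → Edge G u v → L u v ≡ L₀ u v × L v u ≡ L₀ v u

  -- Whatever the lengths of the edges not touching U, one strategy clears U; it may be
  -- started at any time, and ends with X guarded.
  Sweepable : ℕ → List (V G) → (V G → Set) → Set
  Sweepable c X U = ∀ M → Σ[ L₀ ∈ Lengths ] Σ[ Cs ∈ List Cops ]
    ((∀ u v → M ≤ L₀ u v) × All (λ C → length C ≤ c) Cs ×
     (∀ L → Agree U L L₀ → Chase.Forces L (λ _ → ⊤) Cs (λ p → Off X p × Outside U Nowhere p)))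

  guard-fits : ∀ {c X Cs} → length X + 2 ≤ c → All (Guarding X) Cs → All (λ C → length C ≤ c) Cs
  guard-fits X≤ = All.map (λ g → ≤-trans (length-guarding g) X≤)

  nothing-outside : ∀ {U} → (∀ v → ¬ U v) → ∀ p → Outside U Nowhere p
  nothing-outside ¬U (br u)     = ¬U u
  nothing-outside ¬U (hf u v i) = ¬U u , ¬U v

  sweepable-∅ : ∀ {c X U} → length X + 2 ≤ c → (∀ v → ¬ U v) → Sweepable c X U
  sweepable-∅ {X = X} X≤ ¬U M = (λ _ _ → M) , guard X [] ∷ [] , (λ _ _ → ≤-refl) ,
    guard-fits X≤ (([] , refl , z≤n) ∷ []) ,
    λ { _ _ {p = p} _ (Chase.move _ p∉C Chase.done) →
        off-guarding {X} ([] , refl , z≤n) p∉C , nothing-outside ¬U p }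

  -- `Cs₂` is obtained before `L₁`: the edges touching `U₁` must outlast `Cs₂` and all the doublings
  -- while stubs are swept. `Cs₂` ends with `X` guarded, which keeps `U₂` clear during these sweeps.
  sweepable-join : ∀ {c X U₁ U₂ U} → length X + 2 ≤ c → Decidable U₁ →
    Neighbours⊆ U₁ X → Neighbours⊆ U₂ X →
    (∀ {v} → U v → U₁ v ⊎ U₂ v) → (∀ {v} → U₁ v → U v) → (∀ {v} → U₂ v → U v) →
    (∀ {v} → U₁ v → ¬ U₂ v) → (∀ {v} → U₂ v → ¬ v ∈ X) →
    Sweepable c X U₁ → Sweepable c X U₂ → Sweepable c X U
  sweepable-join {c} {X} {U₁} {U₂} {U} X≤ U₁? N₁ N₂ split U₁⊆ U₂⊆ disjoint U₂∩X sw₁ sw₂ M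
    with L₂ , Cs₂ , M≤L₂ , fits₂ , clears₂ ← sw₂ M
    with L₁ , Cs₁ , M≤L₁ , fits₁ , clears₁ ←
           sw₁ (M ⊔ finalDepth arcs (length Cs₂ + 0))
    = L₀ , Cs₁ ++ Cs₂ ++ stubs , M≤L₀ ,
      All.++⁺ fits₁ (All.++⁺ fits₂ (guard-fits X≤ (sweepStubs-guarding X arcs time))) , clears
    where
    time : ℕ
    -- The depth that `drift` yields from depth `0`, that is, from a fully cleared `U₁`.
    time = length Cs₂ + 0
    stubs : List Cops
    stubs = sweepStubs X arcs time
    L₀ : Lengths
    L₀ u v with U₁? u ⊎-dec U₁? v
    ... | yes _ = L₁ u v
    ... | no _  = L₂ u v
    M≤L₀ : ∀ u v → M ≤ L₀ u v
    M≤L₀ u v with U₁? u ⊎-dec U₁? v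
    ... | yes _ = ≤-trans (m≤m⊔n M _) (M≤L₁ u v)
    ... | no _  = M≤L₂ u v
    L₀≡L₁ : ∀ {u v} → U₁ u ⊎ U₁ v → L₀ u v ≡ L₁ u v
    L₀≡L₁ {u} {v} t with U₁? u ⊎-dec U₁? v
    ... | yes _ = refl
    ... | no ¬t = ⊥-elim (¬t t)
    L₀≡L₂ : ∀ {u v} → ¬ (U₁ u ⊎ U₁ v) → L₀ u v ≡ L₂ u v
    L₀≡L₂ {u} {v} ¬t with U₁? u ⊎-dec U₁? v
    ... | yes t = ⊥-elim (¬t t)
    ... | no _  = refl
    -- No edge touches both sets, since neighbours of `U₁` lie in `U₁` or `X`. Hence `L₁` and `L₂`
    -- never compete for an edge.
    untouched : ∀ {u v} → U₂ u → Edge G u v → ¬ (U₁ u ⊎ U₁ v)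
    untouched U₂u e (inj₁ U₁u) = disjoint U₁u U₂u
    untouched U₂u e (inj₂ U₁v) with N₁ U₁v (edge-sym e)
    ... | inj₁ U₁u = disjoint U₁u U₂u
    ... | inj₂ u∈X = U₂∩X U₂u u∈X
    merge : ∀ p → Outside U₁ Nowhere p → Outside U₂ Nowhere p → Outside U Nowhere p
    merge (br u)     out₁       out₂       = Sum.[ out₁ , out₂ ] ∘ split
    merge (hf u v i) (¬u₁ , v₁) (¬u₂ , v₂) = Sum.[ ¬u₁ , ¬u₂ ] ∘ split , Sum.[ v₁ , v₂ ] ∘ split
    clears : ∀ L → Agree U L L₀ →
             Chase.Forces L (λ _ → ⊤) (Cs₁ ++ Cs₂ ++ stubs) (λ p → Off X p × Outside U Nowhere p)
    clears L agree {p = p} _ evade =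
      let q₁ , e₁ , e  = Chase.evade-++⁻ L Cs₁ evade
          q₂ , e₂ , e₃ = Chase.evade-++⁻ L Cs₂ e
          _ , out₁     = clears₁ L agree₁ tt e₁
          off , out₂   = clears₂ L agree₂ tt e₂
          stubs₁       = drift Cs₂ 0 (λ e U₁v → ≤-trans (d≤finalDepth arcs time) (deep e U₁v))
                           (outside-mono (λ ()) q₁ out₁) e₂
          off₃ , out₁₃ = stubs-swept N₁ arcs time deep
                           (off , outside-mono (λ i<time → ∈-arcs , i<time) q₂ stubs₁) e₃
          _ , out₂₃    = off-kept (sweepStubs-guarding X arcs time) (outside-held N₂) (off , out₂) e₃
      in off₃ , merge p out₁₃ out₂₃
      where
      agree₁ : Agree U₁ L L₁
      agree₁ u v U₁u e = let l , r = agree u v (U₁⊆ U₁u) e in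
        ≡.trans l (L₀≡L₁ (inj₁ U₁u)) , ≡.trans r (L₀≡L₁ (inj₂ U₁u))
      agree₂ : Agree U₂ L L₂
      agree₂ u v U₂u e = let l , r = agree u v (U₂⊆ U₂u) e in
        ≡.trans l (L₀≡L₂ (untouched U₂u e)) , ≡.trans r (L₀≡L₂ (untouched U₂u e ∘ Sum.swap))
      deep : ∀ {u v} → Edge G u v → U₁ v → finalDepth arcs time ≤ L u v
      deep {u} {v} e U₁v = subst (finalDepth arcs time ≤_)
        (≡.sym (proj₂ (agree₁ v u U₁v (edge-sym e))))
        (≤-trans (m≤n⊔m M _) (M≤L₁ u v))

  -- Edges that touch `U` but not `U′` join two vertices of `X′`, so they can be swept while `X′` is
  -- guarded. The guard then passes from `X′` to `X` in one round, which is safe because entering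
  -- `U` would require departing from `X′`.
  sweepable-move : ∀ {c X X′ U U′} → length X + 2 ≤ c → length X′ + 2 ≤ c →
    Neighbours⊆ U X′ → Neighbours⊆ U′ X′ →
    (∀ {v} → U v → U′ v ⊎ v ∈ X′) → (∀ {v} → U′ v → U v) →
    Sweepable c X′ U′ → Sweepable c X U
  sweepable-move {c} {X} {X′} {U} {U′} X≤ X′≤ N N′ split U′⊆ sw M
    with L₀ , Cs , M≤L₀ , fits , clears′ ← sw M
    = L₀ , Cs ++ sweeps ++ (guard X [] ∷ []) , M≤L₀ ,
      All.++⁺ fits (All.++⁺ (guard-fits X′≤ (sweepEdges-guarding X′ L₀ arcs))
                            (guard-fits X≤ (([] , refl , z≤n) ∷ []))) , clears
    where
    sweeps : List Cops
    sweeps = sweepEdges X′ L₀ arcs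
    clears : ∀ L → Agree U L L₀ → Chase.Forces L (λ _ → ⊤) (Cs ++ sweeps ++ (guard X [] ∷ []))
                                    (λ p → Off X p × Outside U Nowhere p)
    clears L agree _ evade
      with q₁ , e₁ , e  ← Chase.evade-++⁻ L Cs evade
      with q₂ , e₂ , Chase.move m p∉C Chase.done ← Chase.evade-++⁻ L sweeps e
      with off , out ← clears′ L (λ u v U′u → agree u v (U′⊆ U′u)) tt e₁
      with off₂ , out₂ ← off-kept (sweepEdges-guarding X′ L₀ arcs) (outside-held N′) (off , out) e₂
      = off-guarding {X} ([] , refl , z≤n) p∉C ,
        outside-held {C = []} N (off₂ , cleared q₂ m refl off₂ out₂) m λ ()
      where
      offEdge : ∀ {u v} → U u ⊎ U v → Edge G u v → u ∈ X′ → v ∈ X′ → OffEdge u v q₂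
      offEdge (inj₁ Uu) e u∈X′ v∈X′ = let l , r = agree _ _ Uu e in
        edges-swept arcs off e₂ ∈-arcs u∈X′ v∈X′ l r
      offEdge (inj₂ Uv) e u∈X′ v∈X′ = let l , r = agree _ _ Uv (edge-sym e) in
        edges-swept arcs off e₂ ∈-arcs u∈X′ v∈X′ r l
      absent : ∀ {u v i} → q₂ ≡ hf u v i → Outside U′ Nowhere (hf u v i) → Edge G u v →
               U u ⊎ U v → U′ u ⊎ u ∈ X′ → U′ v ⊎ v ∈ X′ → ⊥
      absent q≡ (¬u , ¬v) e t (inj₁ U′u)  _           = ¬u U′u
      absent q≡ (¬u , ¬v) e t (inj₂ _)    (inj₁ U′v)  = ¬v U′v
      absent q≡ (¬u , ¬v) e t (inj₂ u∈X′) (inj₂ v∈X′) = proj₁ (offEdge t e u∈X′ v∈X′) q≡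
      cleared : ∀ q {p} → Chase.Move L q p → q₂ ≡ q → Off X′ q → Outside U′ Nowhere q →
                Outside U Nowhere q
      cleared (br u)     m q≡ off ¬U′u Uu = Sum.[ ¬U′u , (λ u∈X′ → off u u∈X′ refl) ] (split Uu)
      cleared (hf u v i) m q≡ off out     =
        (λ Uu → absent q≡ out uv (inj₁ Uu) (split Uu) (within (N Uu uv))) ,
        (λ Uv → absent q≡ out uv (inj₂ Uv) (within (N Uv (edge-sym uv))) (split Uv))
        where
        uv : Edge G u v
        -- That the robber still has a move shows that it is on a genuine edge.
        uv = Chase.source-edge L m
        within : ∀ {v} → U v ⊎ v ∈ X′ → U′ v ⊎ v ∈ X′
        within = Sum.[ split , inj₂ ]

-- Subsets as lists, and lookup in duplicate-free lists.

elements : ∀ {n} → Subset n → List (Fin n)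
elements []            = []
elements (inside ∷ p)  = zero ∷ map suc (elements p)
elements (outside ∷ p) = map suc (elements p)

length-elements : ∀ {n} (p : Subset n) → length (elements p) ≡ ∣ p ∣
length-elements []            = refl
length-elements (inside ∷ p)  = cong suc (≡.trans (length-map suc (elements p)) (length-elements p))
length-elements (outside ∷ p) = ≡.trans (length-map suc (elements p)) (length-elements p)

∈-elements⁺ : ∀ {n} {p : Subset n} {x} → x Subset.∈ p → x ∈ elements p
∈-elements⁺ {p = inside ∷ p}  Vec.here        = here refl
∈-elements⁺ {p = inside ∷ p}  (Vec.there x∈p) = there (∈-map⁺ suc (∈-elements⁺ x∈p))
∈-elements⁺ {p = outside ∷ p} (Vec.there x∈p) = ∈-map⁺ suc (∈-elements⁺ x∈p)

∈-elements⁻ : ∀ {n} {p : Subset n} {x} → x ∈ elements p → x Subset.∈ p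
∈-elements⁻ {p = inside ∷ p} (here refl) = Vec.here
∈-elements⁻ {p = inside ∷ p} (there x∈) with _ , y∈ , refl ← ∈-map⁻ suc x∈ =
  Vec.there (∈-elements⁻ y∈)
∈-elements⁻ {p = outside ∷ p} x∈ with _ , y∈ , refl ← ∈-map⁻ suc x∈ = Vec.there (∈-elements⁻ y∈)

lookup-injective : ∀ {A : Set} {xs : List A} → Unique xs →
                   ∀ {i j} → lookup xs i ≡ lookup xs j → i ≡ j
lookup-injective (x∉ ∷ uniq) {zero}  {zero}  eq   = refl
lookup-injective (x∉ ∷ uniq) {zero}  {suc j} refl = ⊥-elim (All.All¬⇒¬Any x∉ (∈-lookup j))
lookup-injective (x∉ ∷ uniq) {suc i} {zero}  refl = ⊥-elim (All.All¬⇒¬Any x∉ (∈-lookup i))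
lookup-injective (x∉ ∷ uniq) {suc i} {suc j} eq   = cong suc (lookup-injective uniq eq)

-- Walks, simple paths and cycles.

module Walks (T : Graph) where

  open Pursuit T using (edge-sym)
  open DecMembership (Fin._≟_ {n T}) using (_∈?_)

  private
    variable
      P Q : V T → Set
      u v w : V T
      xs : List (V T)

  walk-start : WalkIn T P u v → P u
  walk-start (here Pu)     = Pu
  walk-start (step Pu _ _) = Pu

  walk-end : WalkIn T P u v → P v
  walk-end (here Pv)    = Pv
  walk-end (step _ _ p) = walk-end p

  walk-preserves : (∀ {u v} → Q u → P u → P v → Edge T u v → Q v) → Q u → WalkIn T P u v → Q v
  walk-preserves pres Qu (here _)      = Qu
  walk-preserves pres Qu (step Pu e p) = walk-preserves pres (pres Qu Pu (walk-start p) e) p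

  walk-trans : WalkIn T P u v → WalkIn T P v w → WalkIn T P u w
  walk-trans (here _)      q = q
  walk-trans (step Pu e p) q = step Pu e (walk-trans p q)

  walk-sym : WalkIn T P u v → WalkIn T P v u
  walk-sym (here Pu)     = here Pu
  walk-sym (step Pu e p) =
    walk-trans (walk-sym p) (step (walk-start p) (edge-sym e) (here Pu))

  data Path (P : V T → Set) : V T → V T → List (V T) → Set where
    point : P u → Path P u u (u ∷ [])
    cons  : P u → Edge T u w → u ∉ xs → Path P w v xs → Path P u v (u ∷ xs)

  path-from : Path P w v xs → u ∈ xs → ∃[ ys ] Path P u v ys
  path-from p@(point _)      (here refl) = _ , p
  path-from p@(cons _ _ _ _) (here refl) = _ , p
  path-from (cons _ _ _ p)   (there u∈)  = path-from p u∈

  -- Loop erasure: if the start recurs later, the detour in between is cut off.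
  walk⇒path : WalkIn T P u v → ∃[ xs ] Path P u v xs
  walk⇒path (here Pu) = _ , point Pu
  walk⇒path {u = u} (step Pu e p) with xs , q ← walk⇒path p with u ∈? xs
  ... | yes u∈xs = path-from q u∈xs
  ... | no u∉xs  = _ , cons Pu e u∉xs q

  path-all : Path P u v xs → w ∈ xs → P w
  path-all (point Pu)       (here refl) = Pu
  path-all (cons Pu _ _ _)  (here refl) = Pu
  path-all (cons _ _ _ p)   (there w∈)  = path-all p w∈

  path-unique : Path P u v xs → Unique xs
  path-unique (point _)         = [] ∷ []
  path-unique (cons _ _ u∉xs p) = All.¬Any⇒All¬ _ u∉xs ∷ path-unique p

  path-edge : Edge T u w → Path P w v xs → ∀ i →
              Edge T (lookup (u ∷ xs) (inject₁ i)) (lookup xs i)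
  path-edge e (point _)       zero    = e
  path-edge e (cons _ _ _ _)  zero    = e
  path-edge e (cons _ e′ _ p) (suc i) = path-edge e′ p i

  path-end : Path P w v xs → lookup (u ∷ xs) (fromℕ (length xs)) ≡ v
  path-end (point _)      = refl
  path-end (cons _ _ _ p) = path-end p

  -- The vertex `t` closes the path into a cycle. It is new because the path avoids it, and `u ≢ v`
  -- supplies the third vertex.
  cycle-through : ∀ {t} → Edge T t u → Edge T t v → u ≢ v → Path (_≢ t) u v xs → Cycle T
  cycle-through tu tv u≢v (point _) = ⊥-elim (u≢v refl)
  cycle-through {t = t} tu tv u≢v p@(cons {xs = _ ∷ xs} _ _ _ _) = record
    { m     = length xs
    ; c     = lookup (t ∷ _ ∷ _ ∷ xs)
    ; inj   = lookup-injective (All.¬Any⇒All¬ _ (λ t∈ → path-all p t∈ refl) ∷ path-unique p)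
    ; cons  = path-edge tu p
    ; close = subst (λ x → Edge T x t) (≡.sym (path-end {u = t} p)) (edge-sym tv)
    }

-- Branches of a tree at a vertex.

module Ports (T : Graph) (connected : Connected T) (acyclic : Acyclic T) (t : V T) where

  open Pursuit T using (edge-sym)
  open Walks T

  -- Acyclicity enters here; it makes `port` independent of the walk that defines it.
  neighbour-unique : ∀ {u v} → Edge T t u → Edge T t v → WalkIn T (_≢ t) u v → u ≡ v
  neighbour-unique {u} {v} tu tv p with u Fin.≟ v
  ... | yes u≡v = u≡v
  ... | no u≢v  = ⊥-elim (acyclic (cycle-through tu tv u≢v (proj₂ (walk⇒path p))))

  first-hit : ∀ {s} → s ≢ t → WalkIn T (λ _ → ⊤) s t → ∃[ c ] (Edge T t c × WalkIn T (_≢ t) s c)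
  first-hit s≢t (here _) = ⊥-elim (s≢t refl)
  first-hit s≢t (step {w = w} _ e p) with w Fin.≟ t
  ... | yes refl = _ , edge-sym e , here s≢t
  ... | no w≢t   = let c , tc , q = first-hit w≢t p in c , tc , step s≢t e q

  -- The neighbour of t in whose branch s lies (and t itself for s = t).
  port : V T → V T
  port s with s Fin.≟ t
  ... | yes _  = t
  ... | no s≢t = proj₁ (first-hit s≢t (connected s t))

  port-t : port t ≡ t
  port-t with t Fin.≟ t
  ... | yes _  = refl
  ... | no t≢t = ⊥-elim (t≢t refl)

  port-walk : ∀ {s} → s ≢ t → Edge T t (port s) × WalkIn T (_≢ t) s (port s)
  port-walk {s} s≢t with s Fin.≟ t
  ... | yes s≡t = ⊥-elim (s≢t s≡t)
  ... | no s≢t′ = proj₂ (first-hit s≢t′ (connected s t))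

  port-unique : ∀ {s c} → Edge T t c → WalkIn T (_≢ t) s c → port s ≡ c
  port-unique tc p = let tc′ , q = port-walk (walk-start p) in
    neighbour-unique tc′ tc (walk-trans (walk-sym q) p)

  port-edge : ∀ {s r} → s ≢ t → r ≢ t → Edge T s r → port s ≡ port r
  port-edge s≢t r≢t e = let tc , q = port-walk r≢t in port-unique tc (step s≢t e q)

-- Recursion over the tree decomposition.

module Regions (G : Graph) (k : ℕ) (D : TreeDecomp G k) where

  open TreeDecomp D
  open Pursuit G

  private
    module W = Walks tree

  X : V tree → List (V G)
  X t = elements (bag t)

  length-X : ∀ t → length (X t) + 2 ≤ k + 3
  length-X t = begin
    length (X t) + 2 ≡⟨ cong (_+ 2) (length-elements (bag t)) ⟩
    ∣ bag t ∣ + 2    ≤⟨ +-monoˡ-≤ 2 (width t) ⟩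
    suc k + 2        ≡⟨ +-suc k 2 ⟨
    k + 3            ∎
    where open ≤-Reasoning

  Below : List (V tree) → V tree → V G → Set
  Below S t v = ¬ v Subset.∈ bag t × ∃[ s ] (s ∈ S × v Subset.∈ bag s)

  below? : ∀ S t → Decidable (Below S t)
  below? S t v = ¬? (v Subset.∈? bag t) ×-dec
    map′ find (λ { (_ , s∈S , v∈s) → lose s∈S v∈s }) (any? (λ s → v Subset.∈? bag s) S)

  -- When `t ∈ S`, this says that `S` consists of `t` and some entire branches of the tree at `t`.
  Region : List (V tree) → V tree → Set
  Region S t = ∀ {s r} → s ∈ S → s ≢ t → Edge tree s r → r ∈ S

  -- The tree vertices whose bags contain `v` are connected, and without `t` there is no way out of
  -- `S`.
  region-coherent : ∀ {S t v s r} → Region S t → ¬ v Subset.∈ bag t →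
    s ∈ S → v Subset.∈ bag s → v Subset.∈ bag r → r ∈ S
  region-coherent reg v∉t s∈S v∈s v∈r = W.walk-preserves
    (λ s∈S v∈s _ e → reg s∈S (λ { refl → v∉t v∈s }) e) s∈S (coherent _ _ _ v∈s v∈r)

  region-exit : ∀ {S t v s r} → Region S t → s ∈ S → r ∉ S →
    v Subset.∈ bag s → v Subset.∈ bag r → v Subset.∈ bag t
  region-exit {t = t} {v} reg s∈S r∉S v∈s v∈r = decidable-stable (v Subset.∈? bag t)
    λ v∉t → r∉S (region-coherent reg v∉t s∈S v∈s v∈r)

  below-neighbours : ∀ {S t} → Region S t → Neighbours⊆ (Below S t) (X t)
  below-neighbours {t = t} reg {v = v} (u∉t , s , s∈S , u∈s) e
    with r , u∈r , v∈r ← edgeCov _ _ e with v Subset.∈? bag t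
  ... | yes v∈t = inj₂ (∈-elements⁺ v∈t)
  ... | no v∉t  = inj₁ (v∉t , r , region-coherent reg u∉t s∈S u∈s u∈r , v∈r)

  -- One branch `S₁`, entered through the neighbour `c` of `t`, is split off and visited first; the
  -- rest `S₂` keeps `t`. The recursion ends because `S₁` lacks `t` and `S₂` lacks `c`. If `S`
  -- contains only `t`, nothing lies below.
  region-sweepable : ∀ m S t → length S < m → t ∈ S → Region S t →
                     Sweepable (k + 3) (X t) (Below S t)
  region-sweepable (suc m) S t S<m t∈S reg with any? (λ s → ¬? (s Fin.≟ t)) S
  ... | no all≡t = sweepable-∅ (length-X t) λ { v (v∉t , s , s∈S , v∈s) →
          all≡t (lose s∈S λ { refl → v∉t v∈s }) }
  ... | yes some≢t with s₀ , s₀∈S , s₀≢t ← find some≢t =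
    sweepable-join (length-X t) (below? S₁ t) N₁ (below-neighbours reg₂) split
      (λ { (v∉t , s , s∈ , v∈s) → v∉t , s , proj₁ (∈-filter⁻ inBranch? s∈) , v∈s })
      (λ { (v∉t , s , s∈ , v∈s) → v∉t , s , proj₁ (∈-filter⁻ offBranch? s∈) , v∈s })
      (λ { (v∉t , s , s∈ , v∈s) (_ , r , r∈ , v∈r) →
           proj₂ (∈-filter⁻ offBranch? {xs = S} r∈)
                 (proj₂ (∈-filter⁻ inBranch? {xs = S} (coherent₁ v∉t s∈ v∈s v∈r))) })
      (λ { (v∉t , _) v∈X → v∉t (∈-elements⁻ v∈X) })
      (sweepable-move (length-X t) (length-X c) N₁c (below-neighbours reg₁) move-split move-⊆
        (region-sweepable m S₁ c (<-≤-trans S₁<S (s≤s⁻¹ S<m)) c∈S₁ reg₁))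
      (region-sweepable m S₂ t (<-≤-trans S₂<S (s≤s⁻¹ S<m)) t∈S₂ reg₂)
    where
    open Ports tree (proj₁ (proj₂ isTree)) (proj₂ (proj₂ isTree)) t
    c : V tree
    c = port s₀
    tc : Edge tree t c
    tc = proj₁ (port-walk s₀≢t)
    c≢t : c ≢ t
    c≢t = W.walk-end (proj₂ (port-walk s₀≢t))
    c∈S : c ∈ S
    c∈S = W.walk-preserves (λ s∈S s≢t _ e → reg s∈S s≢t e) s₀∈S (proj₂ (port-walk s₀≢t))
    inBranch? : Decidable (λ s → port s ≡ c)
    inBranch? s = port s Fin.≟ c
    offBranch? : Decidable (λ s → port s ≢ c)
    offBranch? s = ¬? (inBranch? s)
    S₁ S₂ : List (V tree)
    S₁ = filter inBranch? S
    S₂ = filter offBranch? S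
    port-t≢c : port t ≢ c
    port-t≢c eq = c≢t (≡.trans (≡.sym eq) port-t)
    t∈S₂ : t ∈ S₂
    t∈S₂ = ∈-filter⁺ offBranch? t∈S port-t≢c
    c∈S₁ : c ∈ S₁
    c∈S₁ = ∈-filter⁺ inBranch? c∈S (port-unique tc (here c≢t))
    t∉S₁ : t ∉ S₁
    t∉S₁ t∈ = port-t≢c (proj₂ (∈-filter⁻ inBranch? {xs = S} t∈))
    S₁<S : length S₁ < length S
    S₁<S = filter-notAll inBranch? S (lose t∈S port-t≢c)
    S₂<S : length S₂ < length S
    S₂<S = filter-notAll offBranch? S (lose c∈S λ ≢c → ≢c (port-unique tc (here c≢t)))
    S₁-edge : ∀ {s r} → s ∈ S₁ → r ≢ t → Edge tree s r → r ∈ S₁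
    S₁-edge {s} s∈ r≢t e with s∈S , s→c ← ∈-filter⁻ inBranch? s∈ =
      ∈-filter⁺ inBranch? (reg s∈S s≢t e) (≡.trans (≡.sym (port-edge s≢t r≢t e)) s→c)
      where
      s≢t : s ≢ t
      s≢t refl = t∉S₁ s∈
    -- The branch can be left towards `t` only from `c`, since any neighbour of `t` is its own port.
    reg₁ : Region S₁ c
    reg₁ {s} {r} s∈ s≢c e = S₁-edge s∈ (λ { refl → s≢c
      (≡.trans (≡.sym (port-unique (edge-sym′ e) (here λ { refl → t∉S₁ s∈ })))
               (proj₂ (∈-filter⁻ inBranch? {xs = S} s∈))) }) e
      where open Pursuit tree using () renaming (edge-sym to edge-sym′)
    reg₂ : Region S₂ t
    reg₂ {s} {r} s∈ s≢t e with s∈S , s↛c ← ∈-filter⁻ offBranch? s∈ with r Fin.≟ t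
    ... | yes refl = t∈S₂
    ... | no r≢t   = ∈-filter⁺ offBranch? (reg s∈S s≢t e) (s↛c ∘ ≡.trans (port-edge s≢t r≢t e))
    coherent₁ : ∀ {v s r} → ¬ v Subset.∈ bag t → s ∈ S₁ → v Subset.∈ bag s →
                v Subset.∈ bag r → r ∈ S₁
    coherent₁ v∉t s∈ v∈s v∈r = W.walk-preserves
      (λ s∈ _ v∈r e → S₁-edge s∈ (λ { refl → v∉t v∈r }) e) s∈ (coherent _ _ _ v∈s v∈r)
    N₁-bag : ∀ {u v} → Below S₁ t u → Edge G u v → ∃[ r ] (r ∈ S₁ × v Subset.∈ bag r)
    N₁-bag (u∉t , s , s∈ , u∈s) e with r , u∈r , v∈r ← edgeCov _ _ e =
      r , coherent₁ u∉t s∈ u∈s u∈r , v∈r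
    N₁ : Neighbours⊆ (Below S₁ t) (X t)
    N₁ {v = v} u e with v Subset.∈? bag t
    ... | yes v∈t = inj₂ (∈-elements⁺ v∈t)
    ... | no v∉t  = inj₁ (v∉t , N₁-bag u e)
    -- A neighbour outside the branch's set lies in bag `t` and in some bag of `S₁`, hence in bag
    -- `c`: the bags of `t` and `c` both separate.
    N₁c : Neighbours⊆ (Below S₁ t) (X c)
    N₁c {v = v} u e with r , r∈ , v∈r ← N₁-bag u e with v Subset.∈? bag t
    ... | yes v∈t = inj₂ (∈-elements⁺ (region-exit reg₁ r∈ t∉S₁ v∈r v∈t))
    ... | no v∉t  = inj₁ (v∉t , r , r∈ , v∈r)
    split : ∀ {v} → Below S t v → Below S₁ t v ⊎ Below S₂ t v
    split (v∉t , s , s∈S , v∈s) with inBranch? s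
    ... | yes s→c = inj₁ (v∉t , s , ∈-filter⁺ inBranch? s∈S s→c , v∈s)
    ... | no s↛c  = inj₂ (v∉t , s , ∈-filter⁺ offBranch? s∈S s↛c , v∈s)
    move-split : ∀ {v} → Below S₁ t v → Below S₁ c v ⊎ v ∈ X c
    move-split {v} (_ , v∈S₁) with v Subset.∈? bag c
    ... | yes v∈c = inj₂ (∈-elements⁺ v∈c)
    ... | no v∉c  = inj₁ (v∉c , v∈S₁)
    move-⊆ : ∀ {v} → Below S₁ c v → Below S₁ t v
    move-⊆ (v∉c , s , s∈ , v∈s) =
      (λ v∈t → v∉c (region-exit reg₁ s∈ t∉S₁ v∈s v∈t)) , s , s∈ , v∈s

  -- The vertices of the root bag are not below the root. A last move, to an empty bag, sweeps the
  -- edges among them.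
  all-sweepable : Sweepable (k + 3) [] (λ _ → ⊤)
  all-sweepable = sweepable-move (≤-trans (m≤n+m 2 (suc k)) (≤-reflexive (≡.sym (+-suc k 2))))
    (length-X root) (λ _ _ → inj₁ tt) (below-neighbours reg) split (λ _ → tt)
    (region-sweepable (suc (length S)) S root ≤-refl (∈-allFin root) reg)
    where
    root : V tree
    root = proj₁ isTree
    S : List (V tree)
    S = allFin (n tree)
    reg : Region S root
    reg _ _ _ = ∈-allFin _
    split : ∀ {v} → ⊤ → Below S root v ⊎ v ∈ X root
    split {v} _ with v Subset.∈? bag root
    ... | yes v∈ = inj₂ (∈-elements⁺ v∈)
    ... | no v∉  = let s , v∈s = vertexCov v in inj₁ (v∉ , s , ∈-allFin s , v∈s)

-- Cardinality of an insertion, and consecutive entries of lists.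

∣insert∣ : ∀ {n} (p : Subset n) x → ∣ p [ x ]≔ inside ∣ ≤ suc ∣ p ∣
∣insert∣ (inside ∷ p)  zero    = n≤1+n _
∣insert∣ (outside ∷ p) zero    = ≤-refl
∣insert∣ (inside ∷ p)  (suc x) = s≤s (∣insert∣ p x)
∣insert∣ (outside ∷ p) (suc x) = ∣insert∣ p x

last-applyUpTo : ∀ {A : Set} (f : ℕ → A) n → last (applyUpTo f (suc n)) ≡ just (f n)
last-applyUpTo f zero    = refl
last-applyUpTo f (suc n) = last-applyUpTo (f ∘ suc) n

last-applyDownFrom : ∀ {A : Set} (f : ℕ → A) n → last (applyDownFrom f (suc n)) ≡ just (f 0)
last-applyDownFrom f zero    = refl
last-applyDownFrom f (suc n) = last-applyDownFrom f n

module _ {A : Set} {x y : A} where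

  consecutive-++ʳ : ∀ xs {ys} → Consecutive x y ys → Consecutive x y (xs ++ ys)
  consecutive-++ʳ xs (as , bs , refl) = xs ++ as , bs , ≡.sym (++-assoc xs as (x ∷ y ∷ bs))

  consecutive-++ˡ : ∀ {xs} ys → Consecutive x y xs → Consecutive x y (xs ++ ys)
  consecutive-++ˡ ys (as , bs , refl) = as , bs ++ ys , ++-assoc as (x ∷ y ∷ bs) ys

  consecutive-middle : ∀ xs ys → Consecutive x y ((xs ++ [ x ]) ++ y ∷ ys)
  consecutive-middle xs ys = xs , ys , ++-assoc xs [ x ] (y ∷ ys)

  consecutive-map⁻ : ∀ {B : Set} {f : A → B} → (∀ {a b} → f a ≡ f b → a ≡ b) →
    ∀ xs → Consecutive (f x) (f y) (map f xs) → Consecutive x y xs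
  consecutive-map⁻ inj (a ∷ b ∷ xs) ([] , _ , eq)
    with fa , eq′ ← ∷-injective eq with fb , _ ← ∷-injective eq′
    with refl ← inj fa | refl ← inj fb = [] , xs , refl
  consecutive-map⁻ inj []       ([] , _ , ())
  consecutive-map⁻ inj (a ∷ []) ([] , _ , ())
  consecutive-map⁻ inj []       (_ ∷ _ , _ , ())
  consecutive-map⁻ inj (a ∷ xs) (_ ∷ as , bs , eq)
    with cs , ds , refl ← consecutive-map⁻ inj xs (as , bs , proj₂ (∷-injective eq)) =
    a ∷ cs , ds , refl

consecutive-applyUpTo : ∀ {A : Set} (f : ℕ → A) {i n} → suc i < n →
                        Consecutive (f i) (f (suc i)) (applyUpTo f n)
consecutive-applyUpTo f {zero}  {suc (suc n)} _       = [] , _ , refl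
consecutive-applyUpTo f {zero}  {suc zero}    (s≤s ())
consecutive-applyUpTo f {suc i} {suc n}       (s≤s i<n) =
  consecutive-++ʳ [ f 0 ] (consecutive-applyUpTo (f ∘ suc) i<n)

consecutive-applyDownFrom : ∀ {A : Set} (f : ℕ → A) {i n} → suc i < n →
                            Consecutive (f (suc i)) (f i) (applyDownFrom f n)
consecutive-applyDownFrom f {i} {suc n} (s≤s i<n) with m≤n⇒m<n∨m≡n i<n
... | inj₁ si<n = consecutive-++ʳ [ f n ] (consecutive-applyDownFrom f si<n)
... | inj₂ refl = [] , _ , refl

-- The subdivision with prescribed lengths.

module Subdivide (G : Graph) (L : V G → V G → ℕ) where

  open Pursuit G

  _≟ᵖ_ : DecidableEquality Position
  br u     ≟ᵖ br v with u Fin.≟ v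
  ... | yes refl = yes refl
  ... | no u≢v   = no λ { refl → u≢v refl }
  br u     ≟ᵖ hf _ _ _ = no λ ()
  hf _ _ _ ≟ᵖ br _     = no λ ()
  hf u v i ≟ᵖ hf x y j with u Fin.≟ x | v Fin.≟ y | i ℕ.≟ j
  ... | yes refl | yes refl | yes refl = yes refl
  ... | no u≢x   | _        | _        = no λ { refl → u≢x refl }
  ... | _        | no v≢y   | _        = no λ { refl → v≢y refl }
  ... | _        | _        | no i≢j   = no λ { refl → i≢j refl }

  Valid : Position → Set
  Valid (br u)     = ⊤
  Valid (hf u v i) = Edge G u v × i ≤ L u v

  valid? : Decidable Valid
  valid? (br u)     = yes tt
  valid? (hf u v i) = T? (adj G u v) ×-dec (i ≤? L u v)

  -- One orientation of adjacency, pointing away from the nearer branch vertex; the middle step of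
  -- an edge appears in both orientations.
  Next : Position → Position → Set
  Next (br u)     (br v)     = ⊥
  Next (br u)     (hf x y j) = u ≡ x × j ≡ 0
  Next (hf u v i) (br x)     = ⊥
  Next (hf u v i) (hf x y j) = (x ≡ u × y ≡ v × j ≡ suc i) ⊎ (x ≡ v × y ≡ u × i ≡ L u v × j ≡ L v u)

  next? : ∀ p q → Dec (Next p q)
  next? (br u)     (br v)     = no id
  next? (br u)     (hf x y j) = (u Fin.≟ x) ×-dec (j ℕ.≟ 0)
  next? (hf u v i) (br x)     = no id
  next? (hf u v i) (hf x y j) =
    ((x Fin.≟ u) ×-dec (y Fin.≟ v) ×-dec (j ℕ.≟ suc i)) ⊎-dec
    ((x Fin.≟ v) ×-dec (y Fin.≟ u) ×-dec (i ℕ.≟ L u v) ×-dec (j ℕ.≟ L v u))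

  loopless : ∀ {u v} → Edge G u v → u ≢ v
  loopless {u} e refl = subst T (Graph.irrefl G u) e

  next-irrefl : ∀ {p} → Valid p → ¬ Next p p
  next-irrefl {hf u v i} (e , _) (inj₁ (_ , _ , i≡))    = 1+n≢n (≡.sym i≡)
  next-irrefl {hf u v i} (e , _) (inj₂ (u≡v , _ , _))   = loopless e u≡v

  halves : V G → V G → List Position
  halves u v = applyUpTo (hf u v) (suc (L u v)) ++ applyDownFrom (hf v u) (suc (L v u))

  route : V G → V G → List Position
  route u v = br u ∷ (halves u v ++ [ br v ])

  ∈-halves⁻ : ∀ {u v p} → p ∈ halves u v → (∃[ i ] (i ≤ L u v × p ≡ hf u v i)) ⊎
                                           (∃[ i ] (i ≤ L v u × p ≡ hf v u i))
  ∈-halves⁻ {u} {v} p∈ with ∈-++⁻ (applyUpTo (hf u v) (suc (L u v))) p∈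
  ... | inj₁ p∈ˡ with i , s≤s i≤ , eq ← ∈-applyUpTo⁻ (hf u v) p∈ˡ = inj₁ (i , i≤ , eq)
  ... | inj₂ p∈ʳ with i , s≤s i≤ , eq ← ∈-applyDownFrom⁻ (hf v u) p∈ʳ = inj₂ (i , i≤ , eq)

  ∈-halves⁺ˡ : ∀ {u v i} → i ≤ L u v → hf u v i ∈ halves u v
  ∈-halves⁺ˡ i≤ = ∈-++⁺ˡ (∈-applyUpTo⁺ (hf _ _) (s≤s i≤))

  ∈-halves⁺ʳ : ∀ {u v i} → i ≤ L v u → hf v u i ∈ halves u v
  ∈-halves⁺ʳ {u} {v} i≤ = ∈-++⁺ʳ (applyUpTo (hf u v) (suc (L u v)))
    (∈-applyDownFrom⁺ (hf v u) (s≤s i≤))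

  halves-valid : ∀ {u v} → Edge G u v → All Valid (halves u v)
  halves-valid {u} {v} e = All.tabulate λ p∈ → valid (∈-halves⁻ p∈)
    where
    valid : ∀ {p} → (∃[ i ] (i ≤ L u v × p ≡ hf u v i)) ⊎ (∃[ i ] (i ≤ L v u × p ≡ hf v u i)) →
            Valid p
    valid (inj₁ (_ , i≤ , refl)) = e , i≤
    valid (inj₂ (_ , i≤ , refl)) = edge-sym e , i≤

  halves-unique : ∀ {u v} → u ≢ v → Unique (halves u v)
  halves-unique {u} {v} u≢v = Unique.++⁺
    (Unique.applyUpTo⁺₁ (hf u v) (suc (L u v)) (λ { i<j _ refl → <-irrefl refl i<j }))
    (Unique.applyDownFrom⁺₁ (hf v u) (suc (L v u)) (λ { j<i _ refl → <-irrefl refl j<i }))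
    λ { (p∈ˡ , p∈ʳ) → clash (∈-applyUpTo⁻ (hf u v) p∈ˡ) (∈-applyDownFrom⁻ (hf v u) p∈ʳ) }
    where
    clash : ∀ {p m n} → (∃[ i ] (i < m × p ≡ hf u v i)) → (∃[ i ] (i < n × p ≡ hf v u i)) → ⊥
    clash (_ , _ , refl) (_ , _ , refl) = u≢v refl

  Adjacent : Position → Position → Set
  Adjacent p q = Next p q ⊎ Next q p

  route-linked : ∀ u v → Linked Adjacent (route u v)
  route-linked u v = inj₁ (refl , refl) ∷ LinkedP.++⁺ (LinkedP.++⁺
      (LinkedP.applyUpTo⁺₁ (hf u v) (suc (L u v)) (λ _ → inj₁ (inj₁ (refl , refl , refl))))
      (subst (λ m → MaybeRelated Adjacent m (just (hf v u (L v u))))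
        (≡.sym (last-applyUpTo (hf u v) (L u v)))
        (just (inj₁ (inj₂ (refl , refl , refl , refl)))))
      (LinkedP.applyDownFrom⁺₁ (hf v u) (suc (L v u)) (λ _ → inj₂ (inj₁ (refl , refl , refl)))))
    (subst (λ m → MaybeRelated Adjacent m (just (br v))) (≡.sym last-halves)
      (just (inj₂ (refl , refl)))) [-]
    where
    last-++ : ∀ (xs : List Position) {y ys} → last (xs ++ y ∷ ys) ≡ last (y ∷ ys)
    last-++ []           = refl
    last-++ (x ∷ [])     = refl
    last-++ (x ∷ x′ ∷ xs) = last-++ (x′ ∷ xs)
    last-halves : last (halves u v) ≡ just (hf v u 0)
    last-halves = ≡.trans (last-++ (applyUpTo (hf u v) (suc (L u v))))
                          (last-applyDownFrom (hf v u) (L v u))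

  Along : V G → V G → Position → Position → Set
  Along u v p q = Consecutive p q (route u v) ⊎ Consecutive q p (route u v)

  along-halves : ∀ {u v p q} → Consecutive p q (halves u v) → Consecutive p q (route u v)
  along-halves {u} {v} c = consecutive-++ʳ [ br u ] (consecutive-++ˡ [ br v ] c)

  leave-forwards : ∀ u v → Consecutive (br u) (hf u v 0) (route u v)
  leave-forwards u v = [] , _ , refl

  leave-backwards : ∀ u v → Consecutive (hf u v 0) (br u) (route v u)
  leave-backwards u v = consecutive-++ʳ [ br v ] (subst
    (λ ps → Consecutive (hf u v 0) (br u) (ps ++ [ br u ]))
    (≡.trans (++-assoc far near [ hf u v 0 ]) (cong (far ++_) (applyDownFrom-∷ʳ (hf u v) (L u v))))
    (consecutive-middle (far ++ near) []))
    where
    far near : List Position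
    far  = applyUpTo (hf v u) (suc (L v u))
    near = applyDownFrom (hf u v ∘ suc) (L u v)

  along-forwards : ∀ u v {i} → suc i ≤ L u v → Consecutive (hf u v i) (hf u v (suc i)) (route u v)
  along-forwards u v i< = along-halves (consecutive-++ˡ (applyDownFrom (hf v u) (suc (L v u)))
    (consecutive-applyUpTo (hf u v) (s≤s i<)))

  along-backwards : ∀ u v {i} → suc i ≤ L u v → Consecutive (hf u v (suc i)) (hf u v i) (route v u)
  along-backwards u v i< = along-halves (consecutive-++ʳ (applyUpTo (hf v u) (suc (L v u)))
    (consecutive-applyDownFrom (hf u v) (s≤s i<)))

  cross-forwards : ∀ u v → Consecutive (hf u v (L u v)) (hf v u (L v u)) (route u v)
  cross-forwards u v = along-halves (subst
    (λ ps → Consecutive (hf u v (L u v)) (hf v u (L v u)) (ps ++ far))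
    (applyUpTo-∷ʳ (hf u v) (L u v))
    (consecutive-middle (applyUpTo (hf u v) (L u v)) (applyDownFrom (hf v u) (L v u))))
    where
    far : List Position
    far = applyDownFrom (hf v u) (suc (L v u))

  -- Both directions are recorded because it is not known here which end of the edge is smaller.
  next-along : ∀ p q → Valid p → Valid q → Next p q →
               ∃[ u ] ∃[ v ] (Edge G u v × Along u v p q × Along v u p q)
  next-along (br u)     (hf u v _) _ (e , _) (refl , refl) =
    u , v , e , inj₁ (leave-forwards u v) , inj₂ (leave-backwards u v)
  next-along (hf u v i) (hf _ _ _) _ (e , i<) (inj₁ (refl , refl , refl)) =
    u , v , e , inj₁ (along-forwards u v i<) , inj₂ (along-backwards u v i<)
  next-along (hf u v _) (hf _ _ _) (e , _) _ (inj₂ (refl , refl , refl , refl)) =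
    u , v , e , inj₁ (cross-forwards u v) , inj₂ (cross-forwards v u)

  ordered : ∀ {p q u v} → Edge G u v → Along u v p q → Along v u p q →
            ∃[ u ] ∃[ v ] (u <ᶠ v × Edge G u v × Along u v p q)
  ordered {u = u} {v} e c c′ with Fin.<-cmp u v
  ... | tri< u<v _ _ = u , v , u<v , e , c
  ... | tri≈ _ u≡v _ = ⊥-elim (loopless e u≡v)
  ... | tri> _ _ v<u = v , u , v<u , edge-sym e , c′

  adjacent-along : ∀ p q → Valid p → Valid q → Adjacent p q →
                   ∃[ u ] ∃[ v ] (u <ᶠ v × Edge G u v × Along u v p q)
  adjacent-along p q Vp Vq (inj₁ pq) = let _ , _ , e , c , c′ = next-along p q Vp Vq pq in
    ordered e c c′
  adjacent-along p q Vp Vq (inj₂ qp) = let _ , _ , e , c , c′ = next-along q p Vq Vp qp in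
    ordered e (Sum.swap c) (Sum.swap c′)

  -- This lists non-edges too, and each edge from both ends; `positions` filters out the former and
  -- removes the repetitions.
  candidates : List Position
  candidates = map br (allFin (n G)) ++ concatMap (λ (u , v) → halves u v) arcs

  ∈-candidates : ∀ p → Valid p → p ∈ candidates
  ∈-candidates (br u)     _        = ∈-++⁺ˡ (∈-map⁺ br (∈-allFin u))
  ∈-candidates (hf u v i) (_ , i≤) = ∈-++⁺ʳ (map br (allFin (n G)))
    (∈-concatMap⁺ (λ (u , v) → halves u v) (lose ∈-arcs (∈-halves⁺ˡ i≤)))

  positions : List Position
  positions = deduplicate _≟ᵖ_ (filter valid? candidates)

  Vertex : Set
  Vertex = Fin (length positions)

  position : Vertex → Position
  position = lookup positions

  position-valid : ∀ x → Valid (position x)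
  position-valid x = proj₂ (∈-filter⁻ valid? {xs = candidates}
    (∈-deduplicate⁻ _≟ᵖ_ (filter valid? candidates) (∈-lookup x)))

  position-injective : ∀ {x y} → position x ≡ position y → x ≡ y
  position-injective = lookup-injective (DecUnique.deduplicate-! _≟ᵖ_ (filter valid? candidates))

  ∈-positions : ∀ {p} → Valid p → p ∈ positions
  ∈-positions {p} Vp = ∈-deduplicate⁺ _≟ᵖ_ (∈-filter⁺ valid? (∈-candidates p Vp) Vp)

  vertex : ∀ {p} → Valid p → Vertex
  vertex Vp = Any.index (∈-positions Vp)

  position-vertex : ∀ {p} (Vp : Valid p) → position (vertex Vp) ≡ p
  position-vertex Vp = ≡.sym (Any.lookup-index (∈-positions Vp))

  H : Graph
  H = record
    { n      = length positions
    ; adj    = λ x y → ⌊ next? (position x) (position y) ⌋ ∨ ⌊ next? (position y) (position x) ⌋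
    ; sym    = λ x y → ∨-comm ⌊ next? (position x) (position y) ⌋ _
    ; irrefl = λ x → irreflexive (next? (position x) (position x)) (next-irrefl (position-valid x))
    }
    where
    irreflexive : ∀ {A : Set} (A? : Dec A) → ¬ A → ⌊ A? ⌋ ∨ ⌊ A? ⌋ ≡ false
    irreflexive (yes a) ¬a = ⊥-elim (¬a a)
    irreflexive (no _)  ¬a = refl

  edge⇒adjacent : ∀ {x y} → Edge H x y → Adjacent (position x) (position y)
  edge⇒adjacent {x} {y} e = Sum.map toWitness toWitness
    (Equivalence.to (T-∨ {⌊ next? (position x) (position y) ⌋}) e)

  adjacent⇒edge : ∀ {x y} → Adjacent (position x) (position y) → Edge H x y
  adjacent⇒edge {x} {y} a = Equivalence.from (T-∨ {⌊ next? (position x) (position y) ⌋})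
    (Sum.map fromWitness fromWitness a)

  vertices : ∀ {ps} → All Valid ps → List Vertex
  vertices = All.reduce vertex

  map-position-vertices : ∀ {ps} (Vps : All Valid ps) → map position (vertices Vps) ≡ ps
  map-position-vertices []         = refl
  map-position-vertices (Vp ∷ Vps) = ≡.cong₂ _∷_ (position-vertex Vp) (map-position-vertices Vps)

  branch : V G → Vertex
  branch u = vertex {br u} tt

  position-branch : ∀ u → position (branch u) ≡ br u
  position-branch u = position-vertex {br u} tt

  -- The value `[]` at non-adjacent pairs is a default: a subdivision constrains only edges.
  inner : V G → V G → List Vertex
  inner u v with T? (adj G u v)
  ... | yes e = vertices (halves-valid e)
  ... | no _  = []

  map-position-inner : ∀ {u v} → Edge G u v → map position (inner u v) ≡ halves u v
  map-position-inner {u} {v} e with T? (adj G u v)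
  ... | yes e′ = map-position-vertices (halves-valid e′)
  ... | no ¬e  = ⊥-elim (¬e e)

  path : V G → V G → List Vertex
  path u v = branch u ∷ (inner u v ++ [ branch v ])

  map-position-path : ∀ {u v} → Edge G u v → map position (path u v) ≡ route u v
  map-position-path {u} {v} e = ≡.cong₂ _∷_ (position-branch u) (≡.trans
    (map-++ position (inner u v) [ branch v ])
    (≡.cong₂ _++_ (map-position-inner e) (cong [_] (position-branch v))))

  ∈-inner⁻ : ∀ {u v x} → Edge G u v → x ∈ inner u v → position x ∈ halves u v
  ∈-inner⁻ e x∈ = subst (_ ∈_) (map-position-inner e) (∈-map⁺ position x∈)

  ∈-inner⁺ : ∀ {u v x} → Edge G u v → position x ∈ halves u v → x ∈ inner u v
  ∈-inner⁺ e p∈ with y , y∈ , eq ← ∈-map⁻ position (subst (_ ∈_) (≡.sym (map-position-inner e)) p∈)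
    with refl ← position-injective eq = y∈

  halves-disjoint : ∀ {u v u′ v′ p} → u <ᶠ v → u′ <ᶠ v′ → p ∈ halves u v → p ∈ halves u′ v′ →
                    u ≡ u′ × v ≡ v′
  halves-disjoint u<v u<v′ p∈ p∈′ with ∈-halves⁻ p∈ | ∈-halves⁻ p∈′
  ... | inj₁ (_ , _ , refl) | inj₁ (_ , _ , refl) = refl , refl
  ... | inj₂ (_ , _ , refl) | inj₂ (_ , _ , refl) = refl , refl
  ... | inj₁ (_ , _ , refl) | inj₂ (_ , _ , refl) = ⊥-elim (<-asym u<v u<v′)
  ... | inj₂ (_ , _ , refl) | inj₁ (_ , _ , refl) = ⊥-elim (<-asym u<v u<v′)

  covered : ∀ x → (∃[ w ] (branch w ≡ x)) ⊎ (∃[ u ] ∃[ v ] (u <ᶠ v × Edge G u v × x ∈ inner u v))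
  covered x = cover (position x) refl (position-valid x)
    where
    cover : ∀ p → position x ≡ p → Valid p →
            (∃[ w ] (branch w ≡ x)) ⊎ (∃[ u ] ∃[ v ] (u <ᶠ v × Edge G u v × x ∈ inner u v))
    cover (br w)     eq _        =
      inj₁ (w , position-injective (≡.trans (position-branch w) (≡.sym eq)))
    cover (hf u v i) eq (e , i≤) with Fin.<-cmp u v
    ... | tri< u<v _ _ =
      inj₂ (u , v , u<v , e , ∈-inner⁺ e (subst (_∈ _) (≡.sym eq) (∈-halves⁺ˡ i≤)))
    ... | tri≈ _ u≡v _ = ⊥-elim (loopless e u≡v)
    ... | tri> _ _ v<u =
      inj₂ (v , u , v<u , edge-sym e ,
        ∈-inner⁺ (edge-sym e) (subst (_∈ _) (≡.sym eq) (∈-halves⁺ʳ i≤)))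

  subdivision : Subdivision G H
  subdivision = record
    { branch         = branch
    ; branchInj      = λ {u} {v} eq → br-injective
        (≡.trans (≡.sym (position-branch u)) (≡.trans (cong position eq) (position-branch v)))
    ; inner          = inner
    ; pathWalk       = λ u v _ e → Linked.map adjacent⇒edge
        (LinkedP.map⁻ (subst (Linked Adjacent) (≡.sym (map-position-path e)) (route-linked u v)))
    ; innerUniq      = λ u v _ e → Unique.map⁻
        (subst Unique (≡.sym (map-position-inner e)) (halves-unique (loopless e)))
    ; innerNotBranch = λ { u v _ e x x∈ w refl →
        br∉halves (subst (_∈ halves u v) (position-branch w) (∈-inner⁻ e x∈)) }
    ; disjoint       = λ _ _ _ _ u<v e u<v′ e′ x x∈ x∈′ →
        halves-disjoint u<v u<v′ (∈-inner⁻ e x∈) (∈-inner⁻ e′ x∈′)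
    ; vertexCov      = covered
    ; edgeCov        = λ x y xy →
        let u , v , u<v , e , c = adjacent-along (position x) (position y)
                                    (position-valid x) (position-valid y) (edge⇒adjacent xy)
        in u , v , u<v , e , Sum.map (pull e) (pull e) c
    }
    where
    br-injective : ∀ {u v} → br u ≡ br v → u ≡ v
    br-injective refl = refl
    br∉halves : ∀ {u v w} → br w ∉ halves u v
    br∉halves p∈ with ∈-halves⁻ p∈
    ... | inj₁ (_ , _ , ())
    ... | inj₂ (_ , _ , ())
    pull : ∀ {u v x y} → Edge G u v → Consecutive (position x) (position y) (route u v) →
           Consecutive x y (path u v)
    pull {u} {v} e c = consecutive-map⁻ position-injective (path u v)
      (subst (Consecutive _ _) (≡.sym (map-position-path e)) c)

  -- Strategies on positions as cop sets of the subdivision.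

  open Chase L

  adjacent⇒move : ∀ p q → Valid p → Valid q → Adjacent p q → Move p q
  adjacent⇒move (br _)     (br _)     _ _ (inj₁ ())
  adjacent⇒move (br _)     (br _)     _ _ (inj₂ ())
  adjacent⇒move (br _)     (hf _ _ _) _ (e , _) (inj₁ (refl , refl)) = leave e
  adjacent⇒move (hf _ _ _) (br _)     (e , _) _ (inj₂ (refl , refl)) = enter e
  adjacent⇒move (hf _ _ i) (hf _ _ _) (e , i≤) (_ , j≤) (inj₁ (inj₁ (refl , refl , refl))) =
    along e ≤-refl (≤-trans (n≤1+n i) (n≤1+n (suc i))) i≤ j≤
  adjacent⇒move (hf _ _ _) (hf _ _ i) (_ , i≤) (e , j≤) (inj₂ (inj₁ (refl , refl , refl))) =
    along e (≤-trans (n≤1+n i) (n≤1+n (suc i))) ≤-refl i≤ j≤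
  adjacent⇒move (hf _ _ _) (hf _ _ _) (e , _) _ (inj₁ (inj₂ (refl , refl , refl , refl))) = cross e
  adjacent⇒move (hf _ _ _) (hf _ _ _) (e , _) _ (inj₂ (inj₂ (refl , refl , refl , refl))) = cross e

  stay : ∀ p → Valid p → Move p p
  stay (br u)     _        = rest
  stay (hf u v i) (e , i≤) = along e (n≤1+n i) (n≤1+n i) i≤ i≤

  -- Sweeps run over all ordered pairs, so some cops stand on positions that are no vertices.
  -- Dropping them is harmless, as no robber is ever there.
  cops : Cops → Subset (n H)
  cops []       = Subset.⊥
  cops (p ∷ ps) with valid? p
  ... | yes Vp = cops ps [ vertex Vp ]≔ inside
  ... | no _   = cops ps

  ∣cops∣ : ∀ ps → ∣ cops ps ∣ ≤ length ps
  ∣cops∣ []       = ≤-reflexive (Subset.∣⊥∣≡0 (n H))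
  ∣cops∣ (p ∷ ps) with valid? p
  ... | yes Vp = ≤-trans (∣insert∣ (cops ps) (vertex Vp)) (s≤s (∣cops∣ ps))
  ... | no _   = m≤n⇒m≤1+n (∣cops∣ ps)

  ∈-cops : ∀ {x ps} → position x ∈ ps → x Subset.∈ cops ps
  ∈-cops {x} {p ∷ ps} p∈ with valid? p
  ∈-cops {x} {p ∷ ps} p∈          | yes Vp with x Fin.≟ vertex Vp
  ∈-cops {x} {p ∷ ps} p∈          | yes Vp | yes refl = Vec.[]≔-updates (cops ps) x
  ∈-cops {x} {p ∷ ps} (here refl) | yes Vp | no x≢    =
    ⊥-elim (x≢ (position-injective (≡.sym (position-vertex Vp))))
  ∈-cops {x} {p ∷ ps} (there p∈)  | yes Vp | no x≢    =
    Vec.[]≔-minimal (cops ps) x (vertex Vp) x≢ (∈-cops p∈)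
  ∈-cops {x} {p ∷ ps} (here refl) | no ¬Vp = ⊥-elim (¬Vp (position-valid x))
  ∈-cops {x} {p ∷ ps} (there p∈)  | no ¬Vp = ∈-cops p∈

  -- Contamination of `u` is traced back round by round to one robber. Forgetting the condition on
  -- `C ∩ C′` only gives the robber more freedom.
  evolve⇒evade : ∀ Cs {C A u} → evolve H C A (map cops Cs) u →
                 ∃[ a ] (A a × Evade Cs (position a) (position u))
  evolve⇒evade []        {u = u} Au = u , Au , done
  evolve⇒evade (C′ ∷ Cs) ev with q , (q∉C′ , a , Aa , how) , e ← evolve⇒evade Cs ev =
    a , Aa , move (moves how) (q∉C′ ∘ ∈-cops) e
    where
    moves : ∀ {S : Set} → a ≡ q ⊎ (Edge H a q × S) → Move (position a) (position q)
    moves (inj₁ refl)     = stay (position q) (position-valid q)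
    moves (inj₂ (aq , _)) = adjacent⇒move (position a) (position q)
      (position-valid a) (position-valid q) (edge⇒adjacent aq)

theorem6p3 : ∀ (G : Graph) (k : ℕ) → Treewidth G k →
    ∃[ H ] (Subdivision G H × BCW₁≤ H (k + 3))
theorem6p3 G k (D , _) with L , Cs , _ , fits , clears ← Regions.all-sweepable G k D 0 =
  -- The empty first cop set contaminates every vertex, which suits a strategy that assumes nothing
  -- about the start.
  H , subdivision , Subset.⊥ , map cops Cs , winning ,
  subst (_≤ k + 3) (≡.sym (Subset.∣⊥∣≡0 (n H))) z≤n ∷
  All.map⁺ (All.map (λ {C} C≤ → ≤-trans (∣cops∣ C) C≤) fits)
  where
  open Subdivide G L
  open Pursuit G using (Position; br; hf; Outside; Nowhere)
  nowhere : ∀ p → ¬ Outside (λ _ → ⊤) Nowhere p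
  nowhere (br u)     out       = out tt
  nowhere (hf u v i) (out , _) = out tt
  winning : Winning H Subset.⊥ (map cops Cs)
  winning u ev = let a , _ , e = evolve⇒evade Cs ev in
    nowhere _ (proj₂ (clears L (λ _ _ _ _ → refl , refl) tt e))
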